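{- Let $G$ be a connected graph such that $\mathrm{Aut}(G[P_2])=\mathrm{Aut}(G)[\mathrm{Aut}(P_2)]$. Then $$D'(G[P_2])\leq \min\Big\{k : \sum_{m=2}^{k}\Big(2\binom{m-1}{1}+m\binom{m-1}{2}+\binom{m-1}{3}\Big)\geq D'(G)\Big\}.$$
   Context: All graphs are finite and simple; $P_2$ is the path on two vertices. For a graph $X$, an edge labeling $\psi:E(X)\to\{1,\dots,d\}$ is distinguishing if the only automorphism of $X$ preserving all edge labels is the identity; the distinguishing index $D'(X)$ is the least $d$ such that $X$ has a distinguishing edge labeling with $d$ labels. The lexicographic product $G[H]$ has vertex set $V(G)\times V(H)$, with $(a,x)$ adjacent to $(b,y)$ iff $ab\in E(G)$, or $a=b$ and $xy\in E(H)$. The wreath product $\mathrm{Aut}(G)[\mathrm{Aut}(H)]$ is the subgroup of $\mathrm{Aut}(G[H])$ consisting of all maps $(g,h)\mapsto(\alpha g,\beta_g h)$ with $\alpha\in\mathrm{Aut}(G)$ and $\beta_g\in\mathrm{Aut}(H)$ for each $g\in V(G)$. -}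

module Defs where

open import Data.Nat using (ℕ; zero; suc; _+_; _*_; _∸_; _≤_; _<_)
open import Data.Nat.Combinatorics using (_C_)
open import Data.Fin using (Fin)
open import Data.Fin.Properties using () renaming (_≟_ to _≟ᶠ_)
open import Data.Bool using (Bool; true; false; _∨_; _∧_; not)
open import Data.Product using (Σ; ∃; _×_; _,_)
open import Relation.Nullary using (¬_)
open import Relation.Nullary.Decidable using (⌊_⌋)
open import Relation.Binary.PropositionalEquality using (_≡_)
open import Function.Bundles using (_↔_; Inverse)

record Graph (V : Set) : Set where
  constructor mkGraph
  field
    adj : V → V → Bool
open Graph public

IsSimple : {V : Set} → Graph V → Set
IsSimple {V} X = (∀ u v → adj X u v ≡ adj X v u) × (∀ v → adj X v v ≡ false)

data Reachable {V : Set} (X : Graph V) : V → V → Set where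
  here : ∀ {v} → Reachable X v v
  step : ∀ {u w v} → adj X u w ≡ true → Reachable X w v → Reachable X u v

Connected : {V : Set} → Graph V → Set
Connected {V} X = ∀ (u v : V) → Reachable X u v

record Aut {V : Set} (X : Graph V) : Set where
  field
    perm : V ↔ V
    preserves : ∀ u v → adj X (Inverse.to perm u) (Inverse.to perm v) ≡ adj X u v
open Aut public

app : {V : Set} {X : Graph V} → Aut X → V → V
app σ = Inverse.to (perm σ)

-- Edge labelings with labels in Fin d (i.e. {1,…,d}); only values on edges matter,
-- and the label of an edge does not depend on the orientation.
record EdgeLabeling {V : Set} (X : Graph V) (d : ℕ) : Set where
  field
    lab : V → V → Fin d
    lab-sym : ∀ u v → adj X u v ≡ true → lab u v ≡ lab v u
open EdgeLabeling public

PreservesLabels : {V : Set} {X : Graph V} {d : ℕ} → EdgeLabeling X d → Aut X → Set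
PreservesLabels {V} {X} ψ σ =
  ∀ u v → adj X u v ≡ true → lab ψ (app σ u) (app σ v) ≡ lab ψ u v

IsDistinguishing : {V : Set} {X : Graph V} {d : ℕ} → EdgeLabeling X d → Set
IsDistinguishing {V} {X} ψ = ∀ (σ : Aut X) → PreservesLabels ψ σ → ∀ v → app σ v ≡ v

HasDistLabeling : {V : Set} → Graph V → ℕ → Set
HasDistLabeling X d = Σ (EdgeLabeling X d) IsDistinguishing

IsDistIndex : {V : Set} → Graph V → ℕ → Set
IsDistIndex X d = HasDistLabeling X d × (∀ d′ → d′ < d → ¬ HasDistLabeling X d′)

DistIndex≤ : {V : Set} → Graph V → ℕ → Set
DistIndex≤ X k = ∃ λ d → d ≤ k × HasDistLabeling X d

P₂ : Graph (Fin 2)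
P₂ = mkGraph (λ x y → not ⌊ x ≟ᶠ y ⌋)

lex : {n m : ℕ} → Graph (Fin n) → Graph (Fin m) → Graph (Fin n × Fin m)
lex G H = mkGraph λ { (a , x) (b , y) → adj G a b ∨ (⌊ a ≟ᶠ b ⌋ ∧ adj H x y) }

InWreath : {n m : ℕ} (G : Graph (Fin n)) (H : Graph (Fin m)) →
           (Fin n × Fin m → Fin n × Fin m) → Set
InWreath {n} G H f =
  Σ (Aut G) λ α → Σ (Fin n → Aut H) λ β →
    ∀ g h → f (g , h) ≡ (app α g , app (β g) h)

WreathEq : {n m : ℕ} → Graph (Fin n) → Graph (Fin m) → Set
WreathEq G H =
  (∀ (φ : Aut (lex G H)) → InWreath G H (app φ)) ×
  (∀ (f : _ → _) → InWreath G H f → Σ (Aut (lex G H)) λ φ → ∀ v → app φ v ≡ f v)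

term : ℕ → ℕ
term m = 2 * ((m ∸ 1) C 1) + m * ((m ∸ 1) C 2) + (m ∸ 1) C 3

S : ℕ → ℕ
S zero = 0
S (suc zero) = 0
S (suc (suc j)) = S (suc j) + term (suc (suc j))

IsMinBound : ℕ → ℕ → Set
IsMinBound d k = d ≤ S k × (∀ k′ → k′ < k → ¬ (d ≤ S k′))

{-# OPTIONS --safe #-}
-- An edge labeling of G[P₂] puts a 2×2 matrix on every edge uv of G (rows: the two copies of u,
-- columns: the two copies of v) and one more label on the edge joining the copies of each vertex.
-- A label of G is encoded in the matrix [[a, b], [c, e]] by a, the set {b, c} with b ≠ c, and
-- ⌊e/2⌋. Each code leaves three matrices with pairwise distinct row-sum differences and pairwise
-- distinct column-sum differences. Hence the two copies of every vertex can be given different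
-- label sums: re-choosing the matrix on any edge at a bad vertex makes both ends of that edge
-- good and affects no other vertex. The label on the edge between the two copies then records
-- which of them has the smaller sum, so a label preserving automorphism cannot exchange copies;
-- it therefore preserves all matrices, hence the labels of G.
-- The k (k C 2) ⌊k/2⌋ codes suffice because 6 S(j + 1) = (j + 1) j (j² + 5). Requiring each
-- single matrix to tell the copies apart would not do: for k > 15, S k exceeds the number
-- (k⁴ + 2k³ − 5k² + 2k) / 8 of such matrices up to row swap, column swap and transposition.
module Submission where

open import Defs
import Algebra.Properties.CommutativeMonoid.Sum
open import Data.Bool using (true; false; if_then_else_)
open import Data.Bool.Properties using (∨-zeroʳ)
open import Data.Fin using (Fin; zero; suc; toℕ; fromℕ; inject₁; inject≤; punchIn; splitAt; join; remQuot; combine)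
  renaming (_<_ to _<ᶠ_)
open import Data.Fin.Properties using (_≟_; toℕ-fromℕ; toℕ-inject₁; toℕ<n; toℕ-injective; punchInᵢ≢i;
  join-splitAt; combine-remQuot; inject≤-injective)
open import Data.List using (List; []; _∷_; allFin)
open import Data.List.Membership.Propositional using (_∈_)
open import Data.List.Membership.Propositional.Properties using (∈-allFin)
open import Data.List.Relation.Unary.Any using (here; there)
open import Data.Nat using (ℕ; zero; suc; _+_; _*_; _⊓_; _⊔_; ⌊_/2⌋; _≤_; _<_; _<?_; z≤n; s≤s; s≤s⁻¹; z<s; s<s)
import Data.Nat as ℕ
open import Data.Nat.Combinatorics using (_C_; nC1≡n; nCk+nC[k+1]≡[n+1]C[k+1])
open import Data.Nat.Properties hiding (_≟_)
open import Data.Nat.Tactic.RingSolver using (solve-∀)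
open import Data.Product using (∃; _×_; _,_; proj₁; proj₂; uncurry)
open import Data.Product.Properties using (,-injectiveˡ; ,-injectiveʳ)
open import Data.Sum using (_⊎_; inj₁; inj₂)
open import Data.Vec.Functional using (removeAt)
open import Function using (_∘_; flip)
open import Relation.Binary.Definitions using (Tri; tri<; tri≈; tri>)
open import Relation.Binary.PropositionalEquality
open import Relation.Nullary using (¬_; Dec; yes; no; does; contradiction)
open import Relation.Nullary.Decidable using (dec-true; dec-false; _×-dec_)
open import Relation.Unary using (Decidable)
open Algebra.Properties.CommutativeMonoid.Sum +-0-commutativeMonoid
  using (sum; sum-remove; sum-permute; sum-cong-≗)

-- Counting: `S k` is at most the number of codes.

triangle : ℕ → ℕ
triangle zero = 0
triangle (suc k) = triangle k + k

capacity : ℕ → ℕ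
capacity k = k * triangle k * ⌊ k /2⌋

2*triangle : ∀ j → 2 * triangle (suc j) ≡ suc j * j
2*triangle zero = refl
2*triangle (suc j) = begin
  2 * (triangle (suc j) + suc j)   ≡⟨ *-distribˡ-+ 2 (triangle (suc j)) (suc j) ⟩
  2 * triangle (suc j) + 2 * suc j ≡⟨ cong (_+ 2 * suc j) (2*triangle j) ⟩
  suc j * j + 2 * suc j            ≡⟨ ring j ⟩
  suc (suc j) * suc j              ∎
  where
  open ≡-Reasoning
  ring : ∀ j → suc j * j + 2 * suc j ≡ suc (suc j) * suc j
  ring = solve-∀

-- Here and in the next lemmas denominators are cleared and negative terms of the polynomial are
-- moved across, so that truncated subtraction never enters.
2*C2 : ∀ n → 2 * (n C 2) + n ≡ n * n
2*C2 zero = refl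
2*C2 (suc n) = begin
  2 * (suc n C 2) + suc n       ≡⟨ cong (λ t → 2 * t + suc n) (sym (nCk+nC[k+1]≡[n+1]C[k+1] n 1)) ⟩
  2 * (n C 1 + n C 2) + suc n   ≡⟨ cong (λ t → 2 * (t + n C 2) + suc n) (nC1≡n n) ⟩
  2 * (n + n C 2) + suc n       ≡⟨ ring n (n C 2) ⟩
  (2 * (n C 2) + n) + (2 * n + 1) ≡⟨ cong (_+ (2 * n + 1)) (2*C2 n) ⟩
  n * n + (2 * n + 1)           ≡⟨ ring′ n ⟩
  suc n * suc n                 ∎
  where
  open ≡-Reasoning
  ring : ∀ n c → 2 * (n + c) + suc n ≡ (2 * c + n) + (2 * n + 1)
  ring = solve-∀
  ring′ : ∀ n → n * n + (2 * n + 1) ≡ suc n * suc n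
  ring′ = solve-∀

6*C3 : ∀ n → 6 * (n C 3) + 3 * (n * n) ≡ n * n * n + 2 * n
6*C3 zero = refl
6*C3 (suc n) = begin
  6 * (suc n C 3) + 3 * (suc n * suc n)
    ≡⟨ cong (λ t → 6 * t + 3 * (suc n * suc n)) (sym (nCk+nC[k+1]≡[n+1]C[k+1] n 2)) ⟩
  6 * (n C 2 + n C 3) + 3 * (suc n * suc n)
    ≡⟨ ring n (n C 2) (n C 3) ⟩
  3 * (2 * (n C 2) + n) + (6 * (n C 3) + 3 * (n * n)) + (3 * n + 3)
    ≡⟨ cong₂ (λ s t → 3 * s + t + (3 * n + 3)) (2*C2 n) (6*C3 n) ⟩
  3 * (n * n) + (n * n * n + 2 * n) + (3 * n + 3)
    ≡⟨ ring′ n ⟩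
  suc n * suc n * suc n + 2 * suc n ∎
  where
  open ≡-Reasoning
  ring : ∀ n c d → 6 * (c + d) + 3 * (suc n * suc n)
       ≡ 3 * (2 * c + n) + (6 * d + 3 * (n * n)) + (3 * n + 3)
  ring = solve-∀
  ring′ : ∀ n → 3 * (n * n) + (n * n * n + 2 * n) + (3 * n + 3)
        ≡ suc n * suc n * suc n + 2 * suc n
  ring′ = solve-∀

6*term : ∀ n → 6 * term (suc n) + (3 * suc n * n + 3 * (n * n))
             ≡ 12 * n + 3 * suc n * (n * n) + (n * n * n + 2 * n)
6*term n = begin
  6 * term (suc n) + (3 * suc n * n + 3 * (n * n))
    ≡⟨ ring n (n C 1) (n C 2) (n C 3) ⟩
  12 * (n C 1) + 3 * suc n * (2 * (n C 2) + n) + (6 * (n C 3) + 3 * (n * n))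
    ≡⟨ cong₂ (λ s t → s + t + (6 * (n C 3) + 3 * (n * n)))
         (cong (12 *_) (nC1≡n n)) (cong (3 * suc n *_) (2*C2 n)) ⟩
  12 * n + 3 * suc n * (n * n) + (6 * (n C 3) + 3 * (n * n))
    ≡⟨ cong (12 * n + 3 * suc n * (n * n) +_) (6*C3 n) ⟩
  12 * n + 3 * suc n * (n * n) + (n * n * n + 2 * n) ∎
  where
  open ≡-Reasoning
  ring : ∀ n b c d → 6 * (2 * b + suc n * c + d) + (3 * suc n * n + 3 * (n * n))
       ≡ 12 * b + 3 * suc n * (2 * c + n) + (6 * d + 3 * (n * n))
  ring = solve-∀

6*S : ∀ j → 6 * S (suc j) ≡ suc j * j * (j * j + 5)
6*S zero = refl
-- The cancelled summand consists of the negative terms that `6*term m` keeps on its left side.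
6*S (suc j) = +-cancelʳ-≡ (3 * suc m * m + 3 * (m * m)) _ _ (begin
  6 * (S m + term (suc m)) + (3 * suc m * m + 3 * (m * m))
    ≡⟨ ring (S m) (term (suc m)) _ ⟩
  6 * S m + (6 * term (suc m) + (3 * suc m * m + 3 * (m * m)))
    ≡⟨ cong₂ _+_ (6*S j) (6*term m) ⟩
  m * j * (j * j + 5) + (12 * m + 3 * suc m * (m * m) + (m * m * m + 2 * m))
    ≡⟨ ring′ j ⟩
  suc m * m * (m * m + 5) + (3 * suc m * m + 3 * (m * m)) ∎)
  where
  open ≡-Reasoning
  m = suc j
  ring : ∀ a b c → 6 * (a + b) + c ≡ 6 * a + (6 * b + c)
  ring = solve-∀
  ring′ : ∀ j → suc j * j * (j * j + 5)
        + (12 * suc j + 3 * suc (suc j) * (suc j * suc j) + (suc j * suc j * suc j + 2 * suc j))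
        ≡ suc (suc j) * suc j * (suc j * suc j + 5)
        + (3 * suc (suc j) * suc j + 3 * (suc j * suc j))
  ring′ = solve-∀

n≤1+2*⌊n/2⌋ : ∀ n → n ≤ suc (2 * ⌊ n /2⌋)
n≤1+2*⌊n/2⌋ zero = z≤n
n≤1+2*⌊n/2⌋ (suc zero) = ≤-refl
n≤1+2*⌊n/2⌋ (suc (suc n)) = ≤-trans (s≤s (s≤s (n≤1+2*⌊n/2⌋ n))) (≤-reflexive (cong suc (sym (*-suc 2 ⌊ n /2⌋))))

-- With k = i + 2 and j = i + 1, this is what remains of the comparison of 6 `S k` with 6
-- `capacity k` once the common factor k j is taken out.
square-bound : ∀ i → suc i * suc i + 5 ≤ 3 * (suc (suc i) * ⌊ suc (suc i) /2⌋)
-- Equality holds at k = 2, where the bound 2⌊k/2⌋ ≥ k - 1 used below would be too weak.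
square-bound zero = ≤-refl
square-bound (suc i) = *-cancelˡ-≤ 2 (begin
  -- The added `i * i + 7 * i` is the exact slack 3(i + 3)(i + 2) - 2((i + 2)² + 5).
  2 * (suc (suc i) * suc (suc i) + 5)               ≤⟨ m≤m+n _ (i * i + 7 * i) ⟩
  2 * (suc (suc i) * suc (suc i) + 5) + (i * i + 7 * i) ≡⟨ ring i ⟩
  3 * suc (suc (suc i)) * suc (suc i)               ≤⟨ *-monoʳ-≤ (3 * suc (suc (suc i))) (s≤s⁻¹ (n≤1+2*⌊n/2⌋ (3 + i))) ⟩
  3 * suc (suc (suc i)) * (2 * ⌊ 3 + i /2⌋)         ≡⟨ ring′ (3 + i) ⌊ 3 + i /2⌋ ⟩
  2 * (3 * (suc (suc (suc i)) * ⌊ 3 + i /2⌋))       ∎)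
  where
  open ≤-Reasoning
  ring : ∀ i → 2 * (suc (suc i) * suc (suc i) + 5) + (i * i + 7 * i) ≡ 3 * suc (suc (suc i)) * suc (suc i)
  ring = solve-∀
  ring′ : ∀ k h → 3 * k * (2 * h) ≡ 2 * (3 * (k * h))
  ring′ = solve-∀

S≤capacity : ∀ k → S k ≤ capacity k
S≤capacity zero = z≤n
S≤capacity (suc zero) = z≤n
S≤capacity k@(suc j@(suc i)) = *-cancelˡ-≤ 6 (begin
  6 * S k                              ≡⟨ 6*S j ⟩
  k * j * (j * j + 5)                  ≤⟨ *-monoʳ-≤ (k * j) (square-bound i) ⟩
  k * j * (3 * (k * ⌊ k /2⌋))          ≡⟨ cong (_* (3 * (k * ⌊ k /2⌋))) (2*triangle j) ⟨
  2 * triangle k * (3 * (k * ⌊ k /2⌋)) ≡⟨ ring k (triangle k) ⌊ k /2⌋ ⟩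
  6 * (k * triangle k * ⌊ k /2⌋)       ∎)
  where
  open ≤-Reasoning
  ring : ∀ k t h → 2 * t * (3 * (k * h)) ≡ 6 * (k * t * h)
  ring = solve-∀

-- Matrices on edges and their orientation-free signatures

Matrix : ℕ → Set
Matrix k = Fin 2 → Fin 2 → Fin k

infix 9 _ᵀ
_ᵀ : ∀ {k} → Matrix k → Matrix k
_ᵀ = flip

matrix : ∀ {k} → Fin k → Fin k → Fin k → Fin k → Matrix k
matrix a b c e zero    zero    = a
matrix a b c e zero    (suc _) = b
matrix a b c e (suc _) zero    = c
matrix a b c e (suc _) (suc _) = e

rowSum : ∀ {k} → Matrix k → Fin 2 → ℕ
rowSum M x = toℕ (M x zero) + toℕ (M x (suc zero))

-- Transposition, which reverses the orientation of an edge, only exchanges the off-diagonal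
-- entries; halving the last entry leaves its parity free.
signature : ∀ {k} → Matrix k → ℕ × ℕ × ℕ × ℕ
signature M = toℕ (M zero zero)
            , toℕ (M zero (suc zero)) ⊓ toℕ (M (suc zero) zero)
            , toℕ (M zero (suc zero)) ⊔ toℕ (M (suc zero) zero)
            , ⌊ toℕ (M (suc zero) (suc zero)) /2⌋

signature-ᵀ : ∀ {k} (M : Matrix k) → signature (M ᵀ) ≡ signature M
signature-ᵀ M = cong₂ (λ p q → toℕ (M zero zero) , p , q , ⌊ toℕ (M (suc zero) (suc zero)) /2⌋)
  (⊓-comm (toℕ (M (suc zero) zero)) _) (⊔-comm (toℕ (M (suc zero) zero)) _)

signature-cong : ∀ {k} {M N : Matrix k} → (∀ x y → M x y ≡ N x y) → signature M ≡ signature N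
signature-cong eq
  rewrite eq zero zero | eq zero (suc zero) | eq (suc zero) zero | eq (suc zero) (suc zero) = refl

-- Enumerating increasing pairs and the two values with a given half

pair′ : ∀ {t} k → (Fin t → Fin k × Fin k) → Fin t ⊎ Fin k → Fin (suc k) × Fin (suc k)
pair′ k f (inj₁ i) = inject₁ (proj₁ (f i)) , inject₁ (proj₂ (f i))
pair′ k f (inj₂ j) = inject₁ j , fromℕ k

-- Follows the recursion of `triangle`: first the pairs below `k`, then those with larger entry `k`.
-- The case split sits in `pair′` so that `pair-injective` can match on two splits at once.
pair : ∀ k → Fin (triangle k) → Fin k × Fin k
pair (suc k) i = pair′ k (pair k) (splitAt (triangle k) i)

pair-< : ∀ k i → toℕ (proj₁ (pair k i)) < toℕ (proj₂ (pair k i))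
pair-< (suc k) i with splitAt (triangle k) i
... | inj₁ j = subst₂ _<_ (sym (toℕ-inject₁ _)) (sym (toℕ-inject₁ _)) (pair-< k j)
... | inj₂ j = subst₂ _<_ (sym (toℕ-inject₁ _)) (sym (toℕ-fromℕ k)) (toℕ<n j)

values : ∀ {k} → Fin k × Fin k → ℕ × ℕ
values (b , c) = toℕ b , toℕ c

pair-injective : ∀ k i j → values (pair k i) ≡ values (pair k j) → i ≡ j
pair-injective (suc k) i j eq = begin
  i ≡⟨ join-splitAt (triangle k) k i ⟨
  join (triangle k) k (splitAt (triangle k) i)
    ≡⟨ cong (join (triangle k) k) (go (splitAt (triangle k) i) (splitAt (triangle k) j) eq) ⟩
  join (triangle k) k (splitAt (triangle k) j) ≡⟨ join-splitAt (triangle k) k j ⟩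
  j ∎
  where
  open ≡-Reasoning
  old≢new : ∀ (b : Fin k) → toℕ (inject₁ b) ≢ toℕ (fromℕ k)
  old≢new b eq = <-irrefl (trans (sym (toℕ-inject₁ b)) (trans eq (toℕ-fromℕ k))) (toℕ<n b)
  go : ∀ s t → values (pair′ k (pair k) s) ≡ values (pair′ k (pair k) t) → s ≡ t
  go (inj₁ s) (inj₁ t) eq = cong inj₁ (pair-injective k s t (cong₂ _,_
    (trans (sym (toℕ-inject₁ _)) (trans (,-injectiveˡ eq) (toℕ-inject₁ _)))
    (trans (sym (toℕ-inject₁ _)) (trans (,-injectiveʳ eq) (toℕ-inject₁ _)))))
  go (inj₁ s) (inj₂ t) eq = contradiction (,-injectiveʳ eq) (old≢new _)
  go (inj₂ s) (inj₁ t) eq = contradiction (sym (,-injectiveʳ eq)) (old≢new _)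
  go (inj₂ s) (inj₂ t) eq = cong inj₂ (toℕ-injective
    (trans (sym (toℕ-inject₁ s)) (trans (,-injectiveˡ eq) (toℕ-inject₁ t))))

-- The two values 2t and 2t + 1 with half `t`. For odd `k` the value k - 1 is never produced.
even odd : ∀ k → Fin ⌊ k /2⌋ → Fin k
even (suc (suc k)) zero    = zero
even (suc (suc k)) (suc t) = suc (suc (even k t))
odd (suc (suc k)) zero    = suc zero
odd (suc (suc k)) (suc t) = suc (suc (odd k t))

odd≡1+even : ∀ k t → toℕ (odd k t) ≡ suc (toℕ (even k t))
odd≡1+even (suc (suc k)) zero    = refl
odd≡1+even (suc (suc k)) (suc t) = cong (λ m → suc (suc m)) (odd≡1+even k t)

⌊even/2⌋ : ∀ k t → ⌊ toℕ (even k t) /2⌋ ≡ toℕ t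
⌊even/2⌋ (suc (suc k)) zero    = refl
⌊even/2⌋ (suc (suc k)) (suc t) = cong suc (⌊even/2⌋ k t)

⌊odd/2⌋ : ∀ k t → ⌊ toℕ (odd k t) /2⌋ ≡ toℕ t
⌊odd/2⌋ (suc (suc k)) zero    = refl
⌊odd/2⌋ (suc (suc k)) (suc t) = cong suc (⌊odd/2⌋ k t)

-- Differences of row sums and the choice among three options

Balances : ∀ {k} → ℕ → ℕ → Matrix k → Set
Balances r s M = rowSum M zero + r ≡ rowSum M (suc zero) + s

-- Equal differences of row sums, with both sides moved so that no subtraction occurs.
balances-difference : ∀ {k r s} (M N : Matrix k) → Balances r s M → Balances r s N →
  rowSum M zero + rowSum N (suc zero) ≡ rowSum N zero + rowSum M (suc zero)
balances-difference {r = r} {s} M N balM balN = +-cancelʳ-≡ (r + s) _ _ (begin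
  M₀ + N₁ + (r + s)   ≡⟨ ring M₀ N₁ r s ⟩
  (M₀ + r) + (N₁ + s) ≡⟨ cong₂ _+_ balM (sym balN) ⟩
  (M₁ + s) + (N₀ + r) ≡⟨ ring′ M₁ s N₀ r ⟩
  N₀ + M₁ + (r + s)   ∎)
  where
  open ≡-Reasoning
  M₀ = rowSum M zero
  M₁ = rowSum M (suc zero)
  N₀ = rowSum N zero
  N₁ = rowSum N (suc zero)
  ring : ∀ a b r s → a + b + (r + s) ≡ (a + r) + (b + s)
  ring = solve-∀
  ring′ : ∀ a s b r → (a + s) + (b + r) ≡ b + a + (r + s)
  ring′ = solve-∀

-- Exchanging `b` and `c` moves the row-sum difference by 2(c - b), which is at least 2, so a change
-- of `e` by one cannot compensate for it.
spread : ∀ a {b c} e → b < c → (a + b) + (b + suc e) < (a + c) + (c + e)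
spread a {b} {c} e b<c = begin
  suc ((a + b) + (b + suc e)) ≡⟨ ring a b e ⟩
  (a + suc b) + (suc b + e)   ≤⟨ +-mono-≤ (+-monoʳ-≤ a b<c) (+-monoˡ-≤ e b<c) ⟩
  (a + c) + (c + e)           ∎
  where
  open ≤-Reasoning
  ring : ∀ a b e → suc ((a + b) + (b + suc e)) ≡ (a + suc b) + (suc b + e)
  ring = solve-∀

spread′ : ∀ a {b c} e → b < c → (a + b) + (b + e) < (a + c) + (c + e)
spread′ a {b} e b<c =
  <-trans (+-monoʳ-< (a + b) (+-monoʳ-< b (n<1+n e))) (spread a e b<c)

shift : ∀ x b e → x + (b + suc e) ≢ x + (b + e)
shift x b e eq = 1+n≢n (+-cancelˡ-≡ b _ _ (+-cancelˡ-≡ x _ _ eq))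

-- Pigeonhole: two predicates, each true of at most one option, cannot exhaust three options.
-- Uniqueness is asked for ordered pairs only, which leaves three comparisons to each application.
avoid-both : {P Q : Fin 3 → Set} → Decidable P → Decidable Q →
  (∀ o o′ → o <ᶠ o′ → P o → ¬ P o′) → (∀ o o′ → o <ᶠ o′ → Q o → ¬ Q o′) →
  ∃ λ o → ¬ P o × ¬ Q o
avoid-both {P} {Q} P? Q? P! Q! with P? zero | Q? zero
... | no ¬p | no ¬q = zero , ¬p , ¬q
... | yes p | yes q = suc zero , P! zero (suc zero) z<s p , Q! zero (suc zero) z<s q
... | yes p | no  _ with Q? (suc zero)
...   | no ¬q = suc zero , P! zero (suc zero) z<s p , ¬q
...   | yes q = suc (suc zero) , P! zero _ z<s p , Q! (suc zero) _ (s<s z<s) q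
avoid-both {P} {Q} P? Q? P! Q! | no _ | yes q with P? (suc zero)
...   | no ¬p = suc zero , ¬p , Q! zero (suc zero) z<s q
...   | yes p = suc (suc zero) , P! (suc zero) _ (s<s z<s) p , Q! zero _ z<s q

-- Codes for the labels of `G` and the three matrices of each code

module Encoding {k d : ℕ} (d≤capacity : d ≤ capacity k) where

  data Code : Set where
    code : Fin k → Fin (triangle k) → Fin ⌊ k /2⌋ → Code

  encode : Fin d → Code
  encode i = uncurry (λ ap t → uncurry (λ a p → code a p t) (remQuot {k} (triangle k) ap))
                     (remQuot {k * triangle k} ⌊ k /2⌋ (inject≤ i d≤capacity))

  decode : Code → Fin (capacity k)
  decode (code a p t) = combine (combine a p) t

  decode-encode : ∀ i → decode (encode i) ≡ inject≤ i d≤capacity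
  decode-encode i = begin
    combine {k * triangle k} (uncurry combine (remQuot {k} (triangle k) ap)) t
      ≡⟨ cong (λ (q : Fin (k * triangle k)) → combine q t) (combine-remQuot {k} (triangle k) ap) ⟩
    combine ap t
      ≡⟨ combine-remQuot {k * triangle k} ⌊ k /2⌋ _ ⟩
    inject≤ i d≤capacity ∎
    where
    open ≡-Reasoning
    ap = proj₁ (remQuot {k * triangle k} ⌊ k /2⌋ (inject≤ i d≤capacity))
    t  = proj₂ (remQuot {k * triangle k} ⌊ k /2⌋ (inject≤ i d≤capacity))

  encode-injective : ∀ i j → encode i ≡ encode j → i ≡ j
  encode-injective i j eq = inject≤-injective _ _ i j
    (trans (sym (decode-encode i)) (trans (cong decode eq) (decode-encode j)))

  optionOf : Code → Fin 3 → Matrix k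
  optionOf (code a p t) zero             = matrix a (proj₁ (pair k p)) (proj₂ (pair k p)) (even k t)
  optionOf (code a p t) (suc zero)       = matrix a (proj₁ (pair k p)) (proj₂ (pair k p)) (even k t) ᵀ
  optionOf (code a p t) (suc (suc zero)) = matrix a (proj₁ (pair k p)) (proj₂ (pair k p)) (odd k t)

  codeSignature : Code → ℕ × ℕ × ℕ × ℕ
  codeSignature (code a p t) = toℕ a , toℕ (proj₁ (pair k p)) , toℕ (proj₂ (pair k p)) , toℕ t

  -- The off-diagonal pair is increasing, transposition merely exchanges it, and the even and odd
  -- last entries have the same half. So the code can be read off whichever option is chosen.
  signature-optionOf : ∀ κ o → signature (optionOf κ o) ≡ codeSignature κ
  signature-optionOf (code a p t) zero
    rewrite m≤n⇒m⊓n≡m (<⇒≤ (pair-< k p)) | m≤n⇒m⊔n≡n (<⇒≤ (pair-< k p)) | ⌊even/2⌋ k t = refl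
  signature-optionOf κ@(code a p t) (suc zero) =
    trans (signature-ᵀ (optionOf κ zero)) (signature-optionOf κ zero)
  signature-optionOf (code a p t) (suc (suc zero))
    rewrite m≤n⇒m⊓n≡m (<⇒≤ (pair-< k p)) | m≤n⇒m⊔n≡n (<⇒≤ (pair-< k p)) | ⌊odd/2⌋ k t = refl

  codeSignature-injective : ∀ κ κ′ → codeSignature κ ≡ codeSignature κ′ → κ ≡ κ′
  codeSignature-injective (code a p t) (code a′ p′ t′) eq
    with refl ← toℕ-injective (,-injectiveˡ eq)
       | refl ← pair-injective k p p′ (cong₂ _,_ (,-injectiveˡ (,-injectiveʳ eq))
                                                  (,-injectiveˡ (,-injectiveʳ (,-injectiveʳ eq))))
       | refl ← toℕ-injective (,-injectiveʳ (,-injectiveʳ (,-injectiveʳ eq))) = refl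

  option : Fin d → Fin 3 → Matrix k
  option = optionOf ∘ encode

  -- Let D = a + b - c - e, where e is the even last entry. The row-sum differences of the three
  -- options are D, D + 2(c - b) and D - 1, all distinct. The numbers `r` and `s` stand for what the
  -- other edges add at the two copies of a vertex; they fix the one difference that balances.
  options-differ : ∀ κ {r s} o o′ → o <ᶠ o′ →
    Balances r s (optionOf κ o) → ¬ Balances r s (optionOf κ o′)
  options-differ κ@(code a p t) zero (suc zero) _ bal bal′ =
    <⇒≢ (spread′ (toℕ a) (toℕ (even k t)) (pair-< k p))
      (balances-difference (optionOf κ zero) (optionOf κ (suc zero)) bal bal′)
  options-differ κ@(code a p t) zero (suc (suc zero)) _ bal bal′
    with eq ← balances-difference (optionOf κ zero) (optionOf κ (suc (suc zero))) bal bal′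
    rewrite odd≡1+even k t = shift (toℕ a + toℕ (proj₁ (pair k p))) (toℕ (proj₂ (pair k p))) (toℕ (even k t)) eq
  options-differ κ@(code a p t) (suc zero) (suc (suc zero)) _ bal bal′
    with eq ← balances-difference (optionOf κ (suc zero)) (optionOf κ (suc (suc zero))) bal bal′
    rewrite odd≡1+even k t =
      >⇒≢ (<-trans (spread′ (toℕ a) (toℕ (even k t)) (pair-< k p))
            (+-monoʳ-< (toℕ a + toℕ (proj₂ (pair k p))) (+-monoʳ-< (toℕ (proj₂ (pair k p))) (n<1+n _)))) eq
  options-differ κ (suc zero) (suc zero) (s<s ())
  options-differ κ (suc (suc zero)) (suc (suc zero)) (s<s (s<s ()))
  options-differ κ (suc (suc zero)) (suc zero) (s<s ())

  -- The column-sum differences are D + 2(c - b), D and D + 2(c - b) - 1, distinct because the even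
  -- number 2(c - b) is neither 0 nor 1.
  optionsᵀ-differ : ∀ κ {r s} o o′ → o <ᶠ o′ →
    Balances r s (optionOf κ o ᵀ) → ¬ Balances r s (optionOf κ o′ ᵀ)
  optionsᵀ-differ κ@(code a p t) zero (suc zero) _ bal bal′ =
    >⇒≢ (spread′ (toℕ a) (toℕ (even k t)) (pair-< k p))
      (balances-difference (optionOf κ zero ᵀ) (optionOf κ (suc zero) ᵀ) bal bal′)
  optionsᵀ-differ κ@(code a p t) zero (suc (suc zero)) _ bal bal′
    with eq ← balances-difference (optionOf κ zero ᵀ) (optionOf κ (suc (suc zero)) ᵀ) bal bal′
    rewrite odd≡1+even k t = shift (toℕ a + toℕ (proj₂ (pair k p))) (toℕ (proj₁ (pair k p))) (toℕ (even k t)) eq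
  optionsᵀ-differ κ@(code a p t) (suc zero) (suc (suc zero)) _ bal bal′
    with eq ← balances-difference (optionOf κ (suc zero) ᵀ) (optionOf κ (suc (suc zero)) ᵀ) bal bal′
    rewrite odd≡1+even k t = <⇒≢ (spread (toℕ a) (toℕ (even k t)) (pair-< k p)) eq
  optionsᵀ-differ κ (suc zero) (suc zero) (s<s ())
  optionsᵀ-differ κ (suc (suc zero)) (suc (suc zero)) (s<s (s<s ()))
  optionsᵀ-differ κ (suc (suc zero)) (suc zero) (s<s ())

  -- Rows belong to one end of an edge and columns to the other, so a single option serves both
  -- ends.
  unbalancing-option : ∀ i r s r′ s′ →
    ∃ λ o → ¬ Balances r s (option i o) × ¬ Balances r′ s′ (option i o ᵀ)
  unbalancing-option i r s r′ s′ = avoid-both (λ _ → _ ℕ.≟ _) (λ _ → _ ℕ.≟ _)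
    (options-differ (encode i)) (optionsᵀ-differ (encode i))

-- Adjacency in the product and existence of neighbours

adj⇒≢ : ∀ {V} {X : Graph V} → IsSimple X → ∀ {u v} → adj X u v ≡ true → u ≢ v
adj⇒≢ (_ , irrefl) {u} uv refl = contradiction (trans (sym (irrefl u)) uv) (λ ())

lex-adj-cross : ∀ {n m} (G : Graph (Fin n)) (H : Graph (Fin m)) {u v x y} →
  adj G u v ≡ true → adj (lex G H) (u , x) (v , y) ≡ true
lex-adj-cross G H {u} {v} uv rewrite uv = refl

lex-adj-fibre : ∀ {n m} (G : Graph (Fin n)) (H : Graph (Fin m)) u {x y} →
  adj H x y ≡ true → adj (lex G H) (u , x) (u , y) ≡ true
lex-adj-fibre G H u xy with u ≟ u
... | yes _  rewrite xy = ∨-zeroʳ (adj G u u)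
... | no u≢u = contradiction refl u≢u

first-edge : ∀ {V} {X : Graph V} {u v} → u ≢ v → Reachable X u v → ∃ λ w → adj X u w ≡ true
first-edge u≢v here        = contradiction refl u≢v
first-edge u≢v (step uw _) = _ , uw

connected⇒neighbour : ∀ {n} {G : Graph (Fin n)} → 2 ≤ n → Connected G → ∀ u → ∃ λ v → adj G u v ≡ true
connected⇒neighbour {suc (suc n)} _ conn zero    = first-edge (λ ()) (conn zero (suc zero))
connected⇒neighbour {suc (suc n)} _ conn (suc u) = first-edge (λ ()) (conn (suc u) zero)
connected⇒neighbour {suc zero} (s≤s ())

-- Choosing the options so that no vertex is balanced

module Weighting {n k d : ℕ} (G : Graph (Fin (suc n))) (simple : IsSimple G)
                 (ψ : EdgeLabeling G d) (d≤capacity : d ≤ capacity k) where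
  open Encoding {k} {d} d≤capacity

  V : Set
  V = Fin (suc n)

  -- On an edge only the entry with the smaller end first is read. `mat` obtains the other
  -- orientation by transposing, so a choice need not be symmetric.
  Choice : Set
  Choice = V → V → Fin 3

  mat : Choice → V → V → Matrix k
  mat o u v with toℕ u <? toℕ v
  ... | yes _ = option (lab ψ u v) (o u v)
  ... | no  _ = option (lab ψ v u) (o v u) ᵀ

  mat-< : ∀ o {u v} → toℕ u < toℕ v → mat o u v ≡ option (lab ψ u v) (o u v)
  mat-< o {u} {v} u<v with toℕ u <? toℕ v
  ... | yes _   = refl
  ... | no  u≮v = contradiction u<v u≮v

  mat-> : ∀ o {u v} → toℕ u < toℕ v → mat o v u ≡ option (lab ψ u v) (o u v) ᵀ
  mat-> o {u} {v} u<v with toℕ v <? toℕ u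
  ... | yes v<u = contradiction v<u (<-asym u<v)
  ... | no  _   = refl

  mat-ᵀ : ∀ o {u v} → u ≢ v → mat o v u ≡ mat o u v ᵀ
  mat-ᵀ o {u} {v} u≢v with <-cmp (toℕ u) (toℕ v)
  ... | tri< u<v _ _ = trans (mat-> o u<v) (cong _ᵀ (sym (mat-< o u<v)))
  ... | tri≈ _ u≡v _ = contradiction (toℕ-injective u≡v) u≢v
  ... | tri> _ _ v<u = trans (mat-< o v<u) (cong _ᵀ (sym (mat-> o v<u)))

  mat-cong : ∀ o o′ {u v} → o u v ≡ o′ u v → o v u ≡ o′ v u → mat o u v ≡ mat o′ u v
  mat-cong o o′ {u} {v} uv vu with toℕ u <? toℕ v
  ... | yes _ = cong (option (lab ψ u v)) uv
  ... | no  _ = cong (λ i → option (lab ψ v u) i ᵀ) vu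

  signature-mat : ∀ o {u v} → adj G u v ≡ true →
    signature (mat o u v) ≡ codeSignature (encode (lab ψ u v))
  signature-mat o {u} {v} uv with toℕ u <? toℕ v
  ... | yes _ = signature-optionOf (encode (lab ψ u v)) (o u v)
  ... | no  _ = begin
    signature (option (lab ψ v u) (o v u) ᵀ) ≡⟨ signature-ᵀ (option (lab ψ v u) (o v u)) ⟩
    signature (option (lab ψ v u) (o v u))   ≡⟨ signature-optionOf (encode (lab ψ v u)) (o v u) ⟩
    codeSignature (encode (lab ψ v u))       ≡⟨ cong (codeSignature ∘ encode) (lab-sym ψ u v uv) ⟨
    codeSignature (encode (lab ψ u v))       ∎
    where open ≡-Reasoning

  weight : Choice → V → Fin 2 → V → ℕ
  weight o u x v = if adj G u v then rowSum (mat o u v) x else 0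

  -- This is the label sum at the vertex `(u , x)` of the product without the edge between the two
  -- copies of `u`, whose label is to depend on these totals.
  total : Choice → V → Fin 2 → ℕ
  total o u x = sum (weight o u x)

  Balanced : Choice → V → Set
  Balanced o u = total o u zero ≡ total o u (suc zero)

  rest : Choice → V → V → Fin 2 → ℕ
  rest o u v x = sum (removeAt (weight o u x) v)

  weight-cong : ∀ o o′ {u v} x → mat o u v ≡ mat o′ u v → weight o u x v ≡ weight o′ u x v
  weight-cong o o′ {u} {v} x eq = cong (λ M → if adj G u v then rowSum M x else 0) eq

  -- `rest` refers to the old choice, so it is known before the new option at `v` is selected and
  -- can serve as the offset in `Balances`.
  total-split : ∀ o o′ {u v} M → adj G u v ≡ true → mat o′ u v ≡ M →
    (∀ w → w ≢ v → mat o′ u w ≡ mat o u w) → ∀ x → total o′ u x ≡ rowSum M x + rest o u v x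
  total-split o o′ {u} {v} M uv eq others x = begin
    total o′ u x                      ≡⟨ sum-remove {i = v} (weight o′ u x) ⟩
    weight o′ u x v + rest o′ u v x   ≡⟨ cong₂ _+_ at-v (sum-cong-≗ (λ w →
                                          weight-cong o′ o {u} {punchIn v w} x (others _ (punchInᵢ≢i v w)))) ⟩
    rowSum M x + rest o u v x         ∎
    where
    open ≡-Reasoning
    at-v : weight o′ u x v ≡ rowSum M x
    at-v rewrite uv | eq = refl

  set : Choice → V → V → Fin 3 → Choice
  set o u v i p q = if does ((p ≟ u) ×-dec (q ≟ v)) then i else o p q

  set-hit : ∀ o u v i → set o u v i u v ≡ i
  set-hit o u v i rewrite dec-true ((u ≟ u) ×-dec (v ≟ v)) (refl , refl) = refl

  set-miss : ∀ o u v i {p q} → ¬ (p ≡ u × q ≡ v) → set o u v i p q ≡ o p q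
  set-miss o u v i {p} {q} miss rewrite dec-false ((p ≟ u) ×-dec (q ≟ v)) miss = refl

  UnbalancesEdge : Choice → V → V → Choice → Set
  UnbalancesEdge o u v o′ = ¬ Balanced o′ u × ¬ Balanced o′ v ×
    (∀ w → w ≢ u → w ≢ v → Balanced o′ w → Balanced o w)

  -- Changing the matrix on uv moves the row sums at u and v only, and each of the two
  -- vertices rules out at most one of the three options.
  unbalance-edge-< : ∀ o {u v} → toℕ u < toℕ v → adj G u v ≡ true → ∃ (UnbalancesEdge o u v)
  unbalance-edge-< o {u} {v} u<v uv
    with i , ¬row , ¬col ← unbalancing-option (lab ψ u v) (rest o u v zero) (rest o u v (suc zero))
                                                           (rest o v u zero) (rest o v u (suc zero))
    = o′
    , (λ bal → ¬row (trans (sym (total-u zero)) (trans bal (total-u (suc zero)))))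
    , (λ bal → ¬col (trans (sym (total-v zero)) (trans bal (total-v (suc zero)))))
    , λ w w≢u w≢v bal → trans (sym (total-w w≢u w≢v zero)) (trans bal (total-w w≢u w≢v (suc zero)))
    where
    o′ = set o u v i
    M = option (lab ψ u v) i
    u≢v : u ≢ v
    u≢v = adj⇒≢ simple uv
    total-u : ∀ x → total o′ u x ≡ rowSum M x + rest o u v x
    total-u = total-split o o′ M uv
      (trans (mat-< o′ u<v) (cong (option (lab ψ u v)) (set-hit o u v i)))
      (λ w w≢v → mat-cong o′ o {u} {w} (set-miss o u v i (w≢v ∘ proj₂)) (set-miss o u v i (u≢v ∘ proj₂)))
    total-v : ∀ x → total o′ v x ≡ rowSum (M ᵀ) x + rest o v u x
    total-v = total-split o o′ (M ᵀ) (trans (proj₁ simple v u) uv)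
      (trans (mat-> o′ u<v) (cong (λ j → option (lab ψ u v) j ᵀ) (set-hit o u v i)))
      (λ w w≢u → mat-cong o′ o {v} {w} (set-miss o u v i (u≢v ∘ sym ∘ proj₁)) (set-miss o u v i (w≢u ∘ proj₁)))
    total-w : ∀ {w} → w ≢ u → w ≢ v → ∀ x → total o′ w x ≡ total o w x
    total-w {w} w≢u w≢v x = sum-cong-≗ λ q → weight-cong o′ o {w} {q} x
      (mat-cong o′ o {w} {q} (set-miss o u v i (w≢u ∘ proj₁)) (set-miss o u v i (w≢v ∘ proj₂)))

  unbalance-edge : ∀ o {u v} → adj G u v ≡ true → ∃ (UnbalancesEdge o u v)
  unbalance-edge o {u} {v} uv = by-order (<-cmp (toℕ u) (toℕ v))
    where
    by-order : Tri (toℕ u < toℕ v) (toℕ u ≡ toℕ v) (toℕ v < toℕ u) → ∃ (UnbalancesEdge o u v)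
    by-order (tri< u<v _ _) = unbalance-edge-< o u<v uv
    by-order (tri≈ _ u≡v _) = contradiction (toℕ-injective u≡v) (adj⇒≢ simple uv)
    by-order (tri> _ _ v<u) =
      let o′ , ¬v , ¬u , others = unbalance-edge-< o v<u (trans (proj₁ simple v u) uv)
      in o′ , ¬u , ¬v , λ w w≢u w≢v → others w w≢v w≢u

  module _ (neighbour : ∀ u → ∃ λ v → adj G u v ≡ true) where

    -- Any edge at `u` will do: its other end also comes out unbalanced and all further vertices
    -- keep their status, so no earlier success is lost.
    unbalance-vertex : ∀ o u → ∃ λ o′ → ¬ Balanced o′ u × (∀ w → ¬ Balanced o w → ¬ Balanced o′ w)
    unbalance-vertex o u
      with v , uv ← neighbour u
      with o′ , ¬u , ¬v , others ← unbalance-edge o uv = o′ , ¬u , keep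
      where
      keep : ∀ w → ¬ Balanced o w → ¬ Balanced o′ w
      keep w ¬w bal with w ≟ u | w ≟ v
      ... | yes refl | _        = ¬u bal
      ... | no _     | yes refl = ¬v bal
      ... | no w≢u   | no w≢v   = ¬w (others w w≢u w≢v bal)

    unbalance-list : (us : List V) → ∃ λ o → ∀ {u} → u ∈ us → ¬ Balanced o u
    -- The starting choice is arbitrary; the vertices are then repaired one after another.
    unbalance-list [] = (λ _ _ → zero) , λ ()
    unbalance-list (u ∷ us)
      with o , ¬us ← unbalance-list us
      with o′ , ¬u , keep ← unbalance-vertex o u
      = o′ , λ { (here refl) → ¬u ; (there w∈us) → keep _ (¬us w∈us) }

    unbalanced-choice : ∃ λ o → ∀ u → ¬ Balanced o u
    unbalanced-choice with o , ¬all ← unbalance-list (allFin (suc n)) = o , λ u → ¬all (∈-allFin u)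

-- Automorphisms of P₂ and the mark for the smaller sum

swap : Fin 2 → Fin 2
swap zero    = suc zero
swap (suc _) = zero

aut-P₂ : (β : Aut P₂) → (∀ x → app β x ≡ x) ⊎ (∀ x → app β x ≡ swap x)
aut-P₂ β with app β zero in eq₀ | app β (suc zero) in eq₁ | preserves β zero (suc zero)
... | zero     | suc zero | _ = inj₁ λ { zero → eq₀ ; (suc zero) → eq₁ }
... | suc zero | zero     | _ = inj₂ λ { zero → eq₀ ; (suc zero) → eq₁ }
-- The two vertices of P₂ are adjacent, so equal images would violate preservation of adjacency.
... | zero     | zero     | ()
... | suc zero | suc zero | ()

-- The automorphism at the column end only reorders two summands. Hence totals at `u` feel the
-- automorphism at `u` itself but not those at its neighbours.
rowSum-aut : ∀ {k} (M : Matrix k) (β : Aut P₂) x →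
  rowSum M x ≡ toℕ (M x (app β zero)) + toℕ (M x (app β (suc zero)))
rowSum-aut M β x with aut-P₂ β
... | inj₁ id rewrite id zero | id (suc zero) = refl
... | inj₂ sw rewrite sw zero | sw (suc zero) = +-comm (toℕ (M x zero)) _

-- Marking one of two copies takes two different labels, hence the index `suc (suc k)`.
smaller : ∀ {k} → ℕ → ℕ → Fin (suc (suc k))
smaller m n = if does (m <? n) then zero else suc zero

smaller-asym : ∀ {k m n} → m ≢ n → smaller {k} n m ≢ smaller m n
smaller-asym {m = m} {n} m≢n with <-cmp m n
... | tri< m<n _ n≮m rewrite dec-true (m <? n) m<n | dec-false (n <? m) n≮m = λ ()
... | tri≈ _ m≡n _   = contradiction m≡n m≢n
... | tri> m≮n _ n<m rewrite dec-false (m <? n) m≮n | dec-true (n <? m) n<m = λ ()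

-- The labeling of the product and why it is distinguishing

module Product {n k d : ℕ} (G : Graph (Fin (suc n))) (simple : IsSimple G)
               (ψ : EdgeLabeling G d) (d≤capacity : d ≤ capacity (suc (suc k))) where
  open Encoding {suc (suc k)} {d} d≤capacity
  open Weighting {k = suc (suc k)} G simple ψ d≤capacity

  module _ (o : Choice) (unbalanced : ∀ u → ¬ Balanced o u) where

    mark : V → Fin (suc (suc k))
    mark u = smaller (total o u zero) (total o u (suc zero))

    label : V × Fin 2 → V × Fin 2 → Fin (suc (suc k))
    label (u , x) (v , y) = if does (u ≟ v) then mark u else mat o u v x y

    label-fibre : ∀ u x y → label (u , x) (u , y) ≡ mark u
    label-fibre u x y rewrite dec-true (u ≟ u) refl = refl

    label-cross : ∀ {u v} → u ≢ v → ∀ x y → label (u , x) (v , y) ≡ mat o u v x y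
    label-cross {u} {v} u≢v x y rewrite dec-false (u ≟ v) u≢v = refl

    label-sym : ∀ p q → label p q ≡ label q p
    label-sym (u , x) (v , y) = go (u ≟ v)
      where
      go : Dec (u ≡ v) → label (u , x) (v , y) ≡ label (v , y) (u , x)
      go (yes refl) = trans (label-fibre u x y) (sym (label-fibre u y x))
      go (no u≢v)   = begin
        label (u , x) (v , y) ≡⟨ label-cross u≢v x y ⟩
        mat o u v x y         ≡⟨ cong (λ M → M y x) (mat-ᵀ o u≢v) ⟨
        mat o v u y x         ≡⟨ label-cross (u≢v ∘ sym) y x ⟨
        label (v , y) (u , x) ∎
        where open ≡-Reasoning

    labeling : EdgeLabeling (lex G P₂) (suc (suc k))
    labeling = record { lab = label ; lab-sym = λ p q _ → label-sym p q }

    module _ (α : Aut G) (β : V → Aut P₂)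
             (fibre : ∀ u → mark (app α u) ≡ mark u)
             (cross : ∀ {u v} → adj G u v ≡ true → ∀ x y →
                mat o (app α u) (app α v) (app (β u) x) (app (β v) y) ≡ mat o u v x y) where

      -- The sum at `app α u` is reindexed along `α`, which maps neighbours to neighbours; `cross`
      -- matches the matrix entries, and `rowSum-aut` absorbs the reordering by `β v`.
      total-invariant : ∀ u x → total o (app α u) (app (β u) x) ≡ total o u x
      total-invariant u x = begin
        total o (app α u) (app (β u) x)                      ≡⟨ sum-permute (weight o (app α u) (app (β u) x)) (perm α) ⟩
        sum (weight o (app α u) (app (β u) x) ∘ app α)       ≡⟨ sum-cong-≗ weights ⟩
        total o u x                                          ∎
        where
        open ≡-Reasoning
        weights : ∀ v → weight o (app α u) (app (β u) x) (app α v) ≡ weight o u x v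
        weights v rewrite preserves α u v with adj G u v in uv
        ... | false = refl
        ... | true  = trans (rowSum-aut (mat o (app α u) (app α v)) (β v) (app (β u) x))
                            (cong₂ (λ a b → toℕ a + toℕ b) (cross uv x zero) (cross uv x (suc zero)))

      -- If `β u` exchanged the copies, the totals at `app α u` would be those at `u` in reverse
      -- order. As these differ, the mark would change, against `fibre`.
      no-swap : ∀ u x → app (β u) x ≡ x
      no-swap u with aut-P₂ (β u)
      ... | inj₁ id = id
      ... | inj₂ sw = contradiction
        (trans (cong₂ smaller
          (trans (sym (total-invariant u (suc zero))) (cong (total o (app α u)) (sw (suc zero))))
          (trans (sym (total-invariant u zero)) (cong (total o (app α u)) (sw zero))))
          (fibre u))
        (smaller-asym (unbalanced u))

      -- Without swaps, `cross` says that matrices are carried over entry by entry. Their signatures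
      -- then agree, and a signature determines the code and thus the label.
      base-preserves : PreservesLabels ψ α
      base-preserves u v uv = encode-injective _ _ (codeSignature-injective _ _ (begin
        codeSignature (encode (lab ψ (app α u) (app α v))) ≡⟨ signature-mat o (trans (preserves α u v) uv) ⟨
        signature (mat o (app α u) (app α v))              ≡⟨ signature-cong mats ⟩
        signature (mat o u v)                              ≡⟨ signature-mat o uv ⟩
        codeSignature (encode (lab ψ u v))                 ∎))
        where
        open ≡-Reasoning
        mats : ∀ x y → mat o (app α u) (app α v) x y ≡ mat o u v x y
        mats x y = trans (sym (cong₂ (mat o (app α u) (app α v)) (no-swap u x) (no-swap v y))) (cross uv x y)

    distinguishing : IsDistinguishing ψ → (∀ φ → InWreath G P₂ (app φ)) → IsDistinguishing labeling
    distinguishing ψ-dist wreath φ pres (u , x) with α , β , φ≗ ← wreath φ = begin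
      app φ (u , x)             ≡⟨ φ≗ u x ⟩
      (app α u , app (β u) x)   ≡⟨ cong₂ _,_ (ψ-dist α (base-preserves α β fibre cross) u) (no-swap α β fibre cross u x) ⟩
      (u , x)                   ∎
      where
      open ≡-Reasoning
      preserved : ∀ {u v} x y → adj (lex G P₂) (u , x) (v , y) ≡ true →
        label (app α u , app (β u) x) (app α v , app (β v) y) ≡ label (u , x) (v , y)
      preserved {u} {v} x y e = trans (sym (cong₂ label (φ≗ u x) (φ≗ v y))) (pres (u , x) (v , y) e)

      fibre : ∀ u → mark (app α u) ≡ mark u
      fibre u = trans (sym (label-fibre (app α u) (app (β u) zero) (app (β u) (suc zero))))
        (trans (preserved zero (suc zero) (lex-adj-fibre G P₂ u {zero} {suc zero} refl)) (label-fibre u zero (suc zero)))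

      cross : ∀ {u v} → adj G u v ≡ true → ∀ x y →
        mat o (app α u) (app α v) (app (β u) x) (app (β v) y) ≡ mat o u v x y
      cross {u} {v} uv x y = trans
        (sym (label-cross (adj⇒≢ simple (trans (preserves α u v) uv)) (app (β u) x) (app (β v) y)))
        (trans (preserved x y (lex-adj-cross G P₂ uv)) (label-cross (adj⇒≢ simple uv) x y))

theorem3p5 : (n : ℕ) (G : Graph (Fin n)) → 2 ≤ n → IsSimple G → Connected G →
    WreathEq G P₂ → (d k : ℕ) → IsDistIndex G d → IsMinBound d k →
    DistIndex≤ (lex G P₂) k
theorem3p5 (suc n) G 2≤n simple conn (wreath , _) zero k ((ψ , _) , _) _
  -- For d = 0 a labeling would have a value in the empty `Fin 0`.
  with v , _ ← connected⇒neighbour 2≤n conn zero with () ← lab ψ zero v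
theorem3p5 (suc n) G 2≤n simple conn (wreath , _) (suc d) (suc (suc k)) ((ψ , ψ-dist) , _) (d≤S , _)
  with o , unbalanced ← Weighting.unbalanced-choice G simple ψ (≤-trans d≤S (S≤capacity (suc (suc k))))
                          (connected⇒neighbour 2≤n conn)
  = suc (suc k) , ≤-refl , labeling o unbalanced , distinguishing o unbalanced ψ-dist wreath
  where open Product {k = k} G simple ψ (≤-trans d≤S (S≤capacity (suc (suc k))))
-- Since `S 0` and `S 1` are 0, a positive d forces k ≥ 2, which supplies the two labels for the
-- marks.
theorem3p5 (suc n) G 2≤n simple conn _ (suc d) zero       _ (() , _)
theorem3p5 (suc n) G 2≤n simple conn _ (suc d) (suc zero) _ (() , _)
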